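{- Let $G$ be a countable group acting on $\mathcal W$ by negligibility-preserving self-homeomorphisms, and let $K\subset\mathcal W$ be a tile that yields a grid for the action of $G$ on $\mathcal W$. Then $\Psi_K$ is a bijection from the set of $\equiv_\lambda$-classes of poly-$K$ tiles $T$ of $\mathcal W$ onto the set of finite tiles (nonempty finite subsets) of $G$, and for every poly-$K$ tile $T$ the cotilers of $T$ in $\mathcal W$ and of $\Psi_K(T)$ in $G$ coincide: a subset $C\subset G$ satisfies $\bigsqcup_{g\in C}g\cdot T\equiv_\lambda\mathcal W$ if and only if $\bigsqcup_{g\in C}g\,\Psi_K(T)=G$.
   Context: $\mathcal W$ is a topological space with a nontrivial Borel measure $\lambda$. A group $G$ acts on $\mathcal W$ by self-homeomorphisms that are negligibility-preserving: $\lambda(A)>0\implies\lambda(g\cdot A)>0$ for all $g\in G$. The relation $\equiv_\lambda$ is equality up to $\lambda$-negligible sets, and $\bigsqcup$ in $\mathcal W$ denotes a union that is disjoint up to $\lambda$-negligible sets; in $G$ (with counting measure, acting on itself by left multiplication) it denotes a genuinely disjoint union. A tile is a positive-measure subset (in $G$: a nonempty subset). A cotiler of a single tile $T$ in $\mathcal W$ is a countable $C\subset G$ with $\bigsqcup_{g\in C}g\cdot T\equiv_\lambda\mathcal W$; similarly in $G$. A tile $K$ yields a grid if $G$ is countable and $\mathcal W\equiv_\lambda\bigsqcup_{h\in G}h\cdot K$. A tile $T$ is a poly-$K$ if there is a finite set $\Psi_K(T)\subset G$ with $T\equiv_\lambda\bigsqcup_{h\in\Psi_K(T)}h\cdot K$.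 -}

module Defs where

open import Level using (Level; 0ℓ; suc; _⊔_)
open import Algebra.Bundles using (Group)
open import Data.List.Base using (List)
open import Data.List.Membership.Setoid using () renaming (_∈_ to member)
open import Data.Nat.Base using (ℕ; zero) renaming (suc to 1+_)
open import Data.Product.Base using (Σ; Σ-syntax; ∃; ∃₂; _×_; _,_; proj₁; proj₂; map₂)
open import Data.Rational.Base as ℚ using (ℚ; 0ℚ)
import Data.Rational.Properties as ℚ
open import Function.Base using (_∘_)
open import Function.Bundles using (Surjection; _⇔_)
open import Function.Structures using (IsBijection)
open import Relation.Binary.Bundles using (Setoid)
open import Relation.Binary.Definitions using (_Respects_)
open import Relation.Binary.PropositionalEquality
  using (_≡_; _≢_; refl; sym; trans; cong; subst) renaming (setoid to ≡-setoid)
open import Relation.Nullary.Negation.Core using (¬_)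
open import Relation.Unary
  using (Pred; _∈_; _⊆_; _≐_; _∩_; _∪_; _∖_; ∁; ⋃; _⊢_; _⊥_; Satisfiable)
open import Relation.Unary.Polymorphic using (∅; U)

private
  variable
    a b c ℓ ℓ₁ ℓ₂ : Level

-- x ∈ [0,∞] is represented by the cut { q ∈ ℚ | q < x }: a rounded lower
-- set containing all negative rationals.  The cut of 0 is the set of
-- negative rationals, and that of ∞ is all of ℚ.

record [0,∞] : Set₁ where
  field
    below    : Pred ℚ 0ℓ
    negative : ∀ {q} → q ℚ.< 0ℚ → q ∈ below
    lower    : ∀ {p q} → p ℚ.≤ q → q ∈ below → p ∈ below
    rounded  : ∀ {q} → q ∈ below → ∃ λ p → q ℚ.< p × p ∈ below

open [0,∞] public

infix 4 _≈∞_

_≈∞_ : [0,∞] → [0,∞] → Set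
x ≈∞ y = below x ≐ below y

Positive : [0,∞] → Set
Positive x = 0ℚ ∈ below x

0∞ : [0,∞]
0∞ = record
  { below    = ℚ._< 0ℚ
  ; negative = λ q<0 → q<0
  ; lower    = ℚ.≤-<-trans
  ; rounded  = ℚ.<-dense
  }

infixl 6 _+∞_

_+∞_ : [0,∞] → [0,∞] → [0,∞]
x +∞ y = record
  { below    = λ q → ∃₂ λ r s → r ∈ below x × s ∈ below y × q ℚ.≤ r ℚ.+ s
  ; negative = neg
  ; lower    = λ p≤q (r , s , r<x , s<y , q≤r+s) →
                 r , s , r<x , s<y , ℚ.≤-trans p≤q q≤r+s
  ; rounded  = λ (r , s , r<x , s<y , q≤r+s) →
                 let (r′ , r<r′ , r′<x) = rounded x r<x
                 in  r′ ℚ.+ s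
                   , ℚ.≤-<-trans q≤r+s (ℚ.+-monoˡ-< s r<r′)
                   , r′ , s , r′<x , s<y , ℚ.≤-refl
  }
  where
  neg : ∀ {q} → q ℚ.< 0ℚ →
        ∃₂ λ r s → r ∈ below x × s ∈ below y × q ℚ.≤ r ℚ.+ s
  neg {q} q<0 =
    let (m , q<m , m<0) = ℚ.<-dense q<0
        q-m<0 = subst ((q ℚ.- m) ℚ.<_) (ℚ.+-inverseʳ m) (ℚ.+-monoˡ-< (ℚ.- m) q<m)
        q-m+m≡q = trans (ℚ.+-assoc q (ℚ.- m) m)
                 (trans (cong (q ℚ.+_) (ℚ.+-inverseˡ m)) (ℚ.+-identityʳ q))
    in  q ℚ.- m , m , negative x q-m<0 , negative y m<0
      , ℚ.≤-reflexive (sym q-m+m≡q)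

sup : (ℕ → [0,∞]) → [0,∞]
sup x = record
  { below    = ⋃ ℕ (below ∘ x)
  ; negative = λ q<0 → 0 , negative (x 0) q<0
  ; lower    = λ p≤q (n , q<xₙ) → n , lower (x n) p≤q q<xₙ
  ; rounded  = λ (n , q<xₙ) → map₂ (map₂ (n ,_)) (rounded (x n) q<xₙ)
  }

partialSum : (ℕ → [0,∞]) → ℕ → [0,∞]
partialSum x zero   = 0∞
partialSum x (1+ n) = partialSum x n +∞ x n

series : (ℕ → [0,∞]) → [0,∞]
series x = sup (partialSum x)

-- The points form a setoid, so that spaces presented as quotients (such
-- as the reals) are covered.  Closure under unions indexed by small types
-- suffices: a union of any collection of open sets is also the union of a
-- family indexed by its own points.

record TopologicalSpace ℓ : Set (suc (suc ℓ)) where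
  field
    setoid : Setoid ℓ ℓ
  open Setoid setoid public renaming (Carrier to Point)
  field
    IsOpen   : Pred (Pred Point ℓ) (suc ℓ)
    respects : ∀ {A} → IsOpen A → A Respects _≈_
    ≐-open   : ∀ {A B} → A ≐ B → IsOpen A → IsOpen B
    ∅-open   : IsOpen ∅
    U-open   : IsOpen U
    ∩-open   : ∀ {A B} → IsOpen A → IsOpen B → IsOpen (A ∩ B)
    ⋃-open   : ∀ {I : Set ℓ} {A : I → Pred Point ℓ} →
               (∀ i → IsOpen (A i)) → IsOpen (⋃ I A)

module _ (X : TopologicalSpace ℓ) where
  open TopologicalSpace X

  image : (Point → Point) → Pred Point ℓ → Pred Point ℓ
  image f A y = Σ[ x ∈ Point ] x ∈ A × f x ≈ y

  record IsSelfHomeomorphism (f : Point → Point) : Set (suc ℓ) where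
    field
      isBijection : IsBijection _≈_ _≈_ f
      continuous  : ∀ {A} → IsOpen A → IsOpen (f ⊢ A)
      openMap     : ∀ {A} → IsOpen A → IsOpen (image f A)

  data Borel : Pred (Pred Point ℓ) (suc ℓ) where
    fromOpen   : ∀ {A} → IsOpen A → Borel A
    complement : ∀ {A} → Borel A → Borel (∁ A)
    union      : ∀ {A : ℕ → Pred Point ℓ} → (∀ n → Borel (A n)) → Borel (⋃ ℕ A)
    ≐-borel    : ∀ {A B} → A ≐ B → Borel A → Borel B

  BorelSet : Set (suc ℓ)
  BorelSet = Σ (Pred Point ℓ) Borel

  Borel-respects : ∀ {A} → Borel A → A Respects _≈_
  Borel-respects (fromOpen o)             x≈y x∈A       = respects o x≈y x∈A
  Borel-respects (complement b)           x≈y x∉A y∈A   =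
    x∉A (Borel-respects b (Setoid.sym setoid x≈y) y∈A)
  Borel-respects (union b)                x≈y (n , x∈A) =
    n , Borel-respects (b n) x≈y x∈A
  Borel-respects (≐-borel (A⊆B , B⊆A) b) x≈y x∈B       =
    A⊆B (Borel-respects b x≈y (B⊆A x∈B))

  module _ {f : Point → Point} (f-homeo : IsSelfHomeomorphism f) where
    open IsSelfHomeomorphism f-homeo
    open IsBijection isBijection using (injective; strictlySurjective)

    image-borel : ∀ {A} → Borel A → Borel (image f A)
    image-borel (fromOpen o) = fromOpen (openMap o)
    image-borel (complement {A} b) =
      ≐-borel (outside , inside) (complement (image-borel b))
      where
      outside : ∁ (image f A) ⊆ image f (∁ A)
      outside {y} y∉fA =
        let (x , fx≈y) = strictlySurjective y
        in  x , (λ x∈A → y∉fA (x , x∈A , fx≈y)) , fx≈y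
      inside : image f (∁ A) ⊆ ∁ (image f A)
      inside (x , x∉A , fx≈y) (x′ , x′∈A , fx′≈y) =
        x∉A (Borel-respects b
              (injective (Setoid.trans setoid fx′≈y (Setoid.sym setoid fx≈y))) x′∈A)
    image-borel (union b) = ≐-borel
      ( (λ (n , x , x∈A , e) → x , (n , x∈A) , e)
      , (λ (x , (n , x∈A) , e) → n , x , x∈A , e))
      (union (λ n → image-borel (b n)))
    image-borel (≐-borel (A⊆B , B⊆A) b) = ≐-borel
      ( (λ (x , x∈A , e) → x , A⊆B x∈A , e)
      , (λ (x , x∈B , e) → x , B⊆A x∈B , e))
      (image-borel b)

    imageBorelSet : BorelSet → BorelSet
    imageBorelSet (A , b) = image f A , image-borel b

record BorelMeasureSpace ℓ : Set (suc (suc ℓ)) where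
  field
    space : TopologicalSpace ℓ
  open TopologicalSpace space public
  field
    measure    : BorelSet space → [0,∞]
    μ-cong     : ∀ {A B} → proj₁ A ≐ proj₁ B → measure A ≈∞ measure B
    μ-∅        : measure (∅ , fromOpen ∅-open) ≈∞ 0∞
    μ-additive : (A : ℕ → BorelSet space) →
                 (∀ {m n} → m ≢ n → proj₁ (A m) ⊥ proj₁ (A n)) →
                 measure (⋃ ℕ (proj₁ ∘ A) , union (proj₂ ∘ A))
                   ≈∞ series (measure ∘ A)
    nontrivial : Positive (measure (U , fromOpen U-open))

module _ (𝒲 : BorelMeasureSpace ℓ) where
  open BorelMeasureSpace 𝒲

  -- For a Borel set, being negligible is the same as having measure zero.
  Negligible : Pred Point ℓ₁ → Set (suc ℓ ⊔ ℓ₁)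
  Negligible A = Σ[ N ∈ BorelSet space ] A ⊆ proj₁ N × measure N ≈∞ 0∞

  EqualUpToNegligible : Pred Point ℓ₁ → Pred Point ℓ₂ → Set (suc ℓ ⊔ ℓ₁ ⊔ ℓ₂)
  EqualUpToNegligible A B = Negligible ((A ∖ B) ∪ (B ∖ A))

  record Tile : Set (suc ℓ) where
    field
      borelSet : BorelSet space
      positive : Positive (measure borelSet)
    set : Pred Point ℓ
    set = proj₁ borelSet

record Subset (S : Setoid a b) ℓ : Set (a ⊔ b ⊔ suc ℓ) where
  open Setoid S
  field
    elements : Pred Carrier ℓ
    respects : elements Respects _≈_

open Subset public using (elements)

Countable : Setoid a b → Set (a ⊔ b)
Countable S = Surjection (≡-setoid ℕ) S

IsFinite : (S : Setoid a b) → Pred (Setoid.Carrier S) ℓ → Set (a ⊔ b ⊔ ℓ)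
IsFinite S A = Σ[ xs ∈ List (Setoid.Carrier S) ] (∀ x → x ∈ A ⇔ member S x xs)

module _ (G : Group ℓ ℓ) where
  open Group G

  record FiniteSubset : Set (suc ℓ) where
    field
      subset : Subset setoid ℓ
      finite : IsFinite setoid (elements subset)

  FiniteTile : Set (suc ℓ)
  FiniteTile = Σ[ S ∈ FiniteSubset ] Satisfiable (elements (FiniteSubset.subset S))

  _≐ᵗ_ : FiniteTile → FiniteTile → Set ℓ
  (S , _) ≐ᵗ (S′ , _) =
    elements (FiniteSubset.subset S) ≐ elements (FiniteSubset.subset S′)

  leftTranslate : Carrier → Pred Carrier ℓ → Pred Carrier ℓ
  leftTranslate g S x = Σ[ s ∈ Carrier ] s ∈ S × g ∙ s ≈ x

  record IsGroupCotiler (S C : Subset setoid ℓ) : Set ℓ where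
    field
      disjoint : ∀ {g h} → g ∈ elements C → h ∈ elements C → ¬ g ≈ h →
                 leftTranslate g (elements S) ⊥ leftTranslate h (elements S)
      covers   : ∀ x → Σ[ g ∈ Carrier ] g ∈ elements C
                                      × x ∈ leftTranslate g (elements S)

record Action (G : Group ℓ ℓ) (𝒲 : BorelMeasureSpace ℓ) : Set (suc ℓ) where
  private module G = Group G
  open BorelMeasureSpace 𝒲
  infixr 7 _·_
  field
    _·_           : G.Carrier → Point → Point
    ·-cong        : ∀ {g h x y} → g G.≈ h → x ≈ y → g · x ≈ h · y
    ·-identity    : ∀ x → G.ε · x ≈ x
    ·-compose     : ∀ g h x → (g G.∙ h) · x ≈ g · (h · x)
    homeomorphism : ∀ g → IsSelfHomeomorphism space (g ·_)
    negligibility-preserving :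
      ∀ g (A : BorelSet space) → Positive (measure A) →
      Positive (measure (imageBorelSet space (homeomorphism g) A))

  infixr 7 _·ˢ_
  _·ˢ_ : G.Carrier → Pred Point ℓ → Pred Point ℓ
  g ·ˢ A = image space (g ·_) A

module _ {G : Group ℓ ℓ} {𝒲 : BorelMeasureSpace ℓ} (α : Action G 𝒲) where
  private module G = Group G
  open BorelMeasureSpace 𝒲
  open Action α

  translates : Pred Point ℓ → Subset G.setoid ℓ → Pred Point ℓ
  translates T C x = Σ[ g ∈ G.Carrier ] g ∈ elements C × x ∈ g ·ˢ T

  -- A ≡_λ ⨆_{g ∈ C} g · T
  record IsTiling (A T : Pred Point ℓ) (C : Subset G.setoid ℓ) : Set (suc ℓ) where
    field
      disjoint : ∀ {g h} → g ∈ elements C → h ∈ elements C → ¬ g G.≈ h →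
                 Negligible 𝒲 ((g ·ˢ T) ∩ (h ·ˢ T))
      covers   : EqualUpToNegligible 𝒲 A (translates T C)

  IsCotiler : Tile 𝒲 → Subset G.setoid ℓ → Set (suc ℓ)
  IsCotiler T C = IsTiling U (Tile.set T) C

  whole : Subset G.setoid ℓ
  whole = record { elements = U ; respects = λ _ x∈U → x∈U }

  YieldsGrid : Tile 𝒲 → Set (suc ℓ)
  YieldsGrid K = Countable G.setoid × IsTiling U (Tile.set K) whole

  record PolyTile (K : Tile 𝒲) : Set (suc ℓ) where
    field
      tile  : Tile 𝒲
      parts : FiniteSubset G
      tiles : IsTiling (Tile.set tile) (Tile.set K) (FiniteSubset.subset parts)

  _≡ᵖ_ : ∀ {K} → PolyTile K → PolyTile K → Set (suc ℓ)
  T ≡ᵖ T′ = EqualUpToNegligible 𝒲 (Tile.set (PolyTile.tile T)) (Tile.set (PolyTile.tile T′))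

  -- The choice of Ψ_K(T) is carried by the poly-tile, so independence of this
  -- choice amounts to Ψ being congruent with respect to _≡ᵖ_.
  Ψ : ∀ {K} → PolyTile K → FiniteSubset G
  Ψ = PolyTile.parts

  Ψˢ : ∀ {K} → PolyTile K → Subset G.setoid ℓ
  Ψˢ T = FiniteSubset.subset (Ψ T)

{-# OPTIONS --safe #-}

-- Write ⟨S⟩ for the union of the cells h · K over h ∈ S ⊆ G.  The points
-- lying in two different cells form a negligible set because G is countable,
-- and no cell is negligible.  Hence ⟨S⟩ ⊆ ⟨S′⟩ up to negligible sets exactly
-- when S ⊆ S′, and ⟨S⟩ ∩ ⟨S′⟩ is negligible exactly when S and S′ are
-- disjoint.  As g · ⟨S⟩ = ⟨gS⟩, tiling conditions on T ≡_λ ⟨Ψ_K(T)⟩ turn into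
-- the same conditions on Ψ_K(T) in G.
module Submission where

open import Defs
open import Level using (Level; suc; _⊔_; Lift; lift)
open import Algebra.Bundles using (Group)
open import Axiom.ExcludedMiddle using (ExcludedMiddle)
open import Data.Empty using (⊥-elim)
open import Data.Nat.Base as ℕ using (ℕ; zero) renaming (suc to 1+_)
import Data.Nat.Properties as ℕ
open import Data.Product.Base using (Σ-syntax; ∃₂; _×_; _,_; proj₁; proj₂)
open import Data.Rational.Base as ℚ using (0ℚ)
import Data.Rational.Properties as ℚ
open import Data.Sum.Base using (inj₁; inj₂; [_,_])
open import Data.Unit.Polymorphic using (tt)
open import Function.Base using (_∘_; id)
open import Function.Bundles using (Surjection; _⇔_; mk⇔)
open import Function.Structures using (IsBijection)
open import Relation.Binary.Definitions using (tri<; tri≈; tri>)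
open import Relation.Binary.PropositionalEquality as ≡ using (_≢_)
open import Relation.Binary.Structures using (IsEquivalence)
open import Relation.Nullary.Decidable.Core using (yes; no; map′; decidable-stable)
open import Relation.Nullary.Negation.Core using (¬_)
open import Relation.Unary
  using (Pred; _∈_; _∉_; _⊆_; _≐_; _∩_; _∪_; _∖_; ⋃; _⊥_; Satisfiable)
open import Relation.Unary.Polymorphic using (∅; U)
open import Relation.Unary.Properties using (≐-refl; ≐-sym; ≐-trans)

private
  variable
    a b ℓ : Level

-- Negligibility lives one level above membership in a set of points, and positivity at the bottom
-- level; one hypothesis has to serve them all.
lower-em : ExcludedMiddle (a ⊔ b) → ExcludedMiddle a
lower-em {b = b} em {P} = map′ Level.lower lift (em {Lift b P})

-- Zero and positivity in the extended half-line.

¬Positive⇒≈0∞ : ∀ x → ¬ Positive x → x ≈∞ 0∞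
¬Positive⇒≈0∞ x x≯0 = below-negative , negative x
  where
  below-negative : ∀ {q} → q ∈ below x → q ℚ.< 0ℚ
  below-negative {q} q<x =
    -- A nonnegative `q` in the lower cut of `x` would put zero in it as well.
    decidable-stable (q ℚ.<? 0ℚ) (λ q≮0 → x≯0 (lower x (ℚ.≮⇒≥ q≮0) q<x))

≈0∞⇒¬Positive : ∀ x → x ≈∞ 0∞ → ¬ Positive x
≈0∞⇒¬Positive _ (x≤0 , _) x>0 = ℚ.<-irrefl ≡.refl (x≤0 x>0)

Positive-head⇒series : ∀ x → Positive (x 0) → Positive (series x)
Positive-head⇒series x x₀>0 =
  let (s , 0<s , s<x₀) = rounded (x 0) x₀>0
  -- The first partial sum is `0∞ +∞ x 0`, and only negative rationals lie below `0∞`. Roundedness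
  -- supplies some `s` strictly above zero, so that `- s` is available as the left summand.
  in  1 , ℚ.- s , s , ℚ.neg-antimono-< 0<s , s<x₀
    , ℚ.≤-reflexive (≡.sym (ℚ.+-inverseˡ s))

series-0∞ : ∀ x → (∀ n → x n ≈∞ 0∞) → series x ≈∞ 0∞
series-0∞ x x≈0 = (λ (n , q<Σ) → partialSum≤0 n q<Σ) , negative (series x)
  where
  partialSum≤0 : ∀ n {q} → q ∈ below (partialSum x n) → q ℚ.< 0ℚ
  partialSum≤0 zero   q<0 = q<0
  partialSum≤0 (1+ n) (r , s , r<Σ , s<xₙ , q≤r+s) =
    ℚ.≤-<-trans q≤r+s
      (ℚ.+-mono-< {y = 0ℚ} (partialSum≤0 n r<Σ) (proj₁ (x≈0 n) s<xₙ))

-- Borel sets, null sets and negligible sets.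

module MeasureTheory (em : ExcludedMiddle (suc ℓ)) (𝒲 : BorelMeasureSpace ℓ) where
  open BorelMeasureSpace 𝒲

  dec : ExcludedMiddle ℓ
  dec = lower-em em

  BSet : Set (suc ℓ)
  BSet = BorelSet space

  IsBorel : Pred (Pred Point ℓ) (suc ℓ)
  IsBorel = Borel space

  Negl : Pred (Pred Point ℓ) (suc ℓ)
  Negl = Negligible 𝒲

  ∅ᴮ : BSet
  ∅ᴮ = ∅ , fromOpen ∅-open

  ∪-borel : ∀ {A B} → IsBorel A → IsBorel B → IsBorel (A ∪ B)
  ∪-borel {A} {B} bA bB = ≐-borel
    ( (λ { (zero , x∈A) → inj₁ x∈A ; (1+ _ , x∈B) → inj₂ x∈B })
    , [ (0 ,_) , (1 ,_) ]) (union borel)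
    where
    family : ℕ → Pred Point ℓ
    family zero   = A
    family (1+ _) = B
    borel : ∀ n → IsBorel (family n)
    borel zero   = bA
    borel (1+ _) = bB

  ∖-borel : ∀ {A B} → IsBorel A → IsBorel B → IsBorel (A ∖ B)
  ∖-borel bA bB = ≐-borel
    ( (λ x∉ → decidable-stable dec (x∉ ∘ inj₁) , x∉ ∘ inj₂)
    , (λ (x∈A , x∉B) → [ (λ x∉A → x∉A x∈A) , x∉B ]))
    (complement (∪-borel (complement bA) bB))

  -- Lets a countable union be restricted to those indices that satisfy an arbitrary condition: the
  -- guarded set is either `A` or empty.
  guard-borel : ∀ {P : Set ℓ} {A} → IsBorel A → IsBorel (λ x → P × x ∈ A)
  guard-borel {P} bA with dec {P}
  ... | yes p = ≐-borel ((p ,_) , proj₂) bA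
  ... | no ¬p = ≐-borel ((λ ()) , (λ (p , _) → ⊥-elim (¬p p))) (fromOpen ∅-open)

  -- Monotonicity comes from countable additivity: `B` splits into `A`, the rest of `B`, and empty
  -- sets. `A` stands at index zero, where `Positive-head⇒series` makes its positivity pass to `B`.
  null-⊆ : ∀ {A B : BSet} → proj₁ A ⊆ proj₁ B → measure B ≈∞ 0∞ → measure A ≈∞ 0∞
  null-⊆ {A , bA} {B , bB} A⊆B B≈0 = ¬Positive⇒≈0∞ (measure (A , bA)) λ A>0 →
    ≈0∞⇒¬Positive (measure (B , bB)) B≈0 (proj₁ (μ-cong (⋃⊆B , B⊆⋃))
      (proj₂ (μ-additive pieces disjoint) (Positive-head⇒series (measure ∘ pieces) A>0)))
    where
    pieces : ℕ → BSet
    pieces 0           = A , bA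
    pieces 1           = B ∖ A , ∖-borel bB bA
    pieces (1+ (1+ _)) = ∅ᴮ

    disjoint : ∀ {m n} → m ≢ n → proj₁ (pieces m) ⊥ proj₁ (pieces n)
    disjoint {0} {0} m≢n _ = m≢n ≡.refl
    disjoint {0} {1} _ (x∈A , _ , x∉A) = x∉A x∈A
    disjoint {0} {1+ (1+ _)} _ (_ , ())
    disjoint {1} {0} _ ((_ , x∉A) , x∈A) = x∉A x∈A
    disjoint {1} {1} m≢n _ = m≢n ≡.refl
    disjoint {1} {1+ (1+ _)} _ (_ , ())
    disjoint {1+ (1+ _)} _ (() , _)

    ⋃⊆B : ⋃ ℕ (proj₁ ∘ pieces) ⊆ B
    ⋃⊆B (0 , x∈A)       = A⊆B x∈A
    ⋃⊆B (1 , x∈B , _)   = x∈B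

    B⊆⋃ : B ⊆ ⋃ ℕ (proj₁ ∘ pieces)
    B⊆⋃ {x} x∈B with dec {x ∈ A}
    ... | yes x∈A = 0 , x∈A
    ... | no  x∉A = 1 , x∈B , x∉A

  -- Additivity speaks of disjoint families only, so each `N n` is first stripped of the union
  -- `before n` of its predecessors. The pieces `fresh n` stay null by monotonicity and have the
  -- same union.
  null-⋃ : (N : ℕ → BSet) → (∀ n → measure (N n) ≈∞ 0∞) →
           measure (⋃ ℕ (proj₁ ∘ N) , union (proj₂ ∘ N)) ≈∞ 0∞
  null-⋃ N N≈0 = ≐-trans
    (μ-cong ((λ (n , x∈N) → N⊆⋃fresh n x∈N) , (λ (n , x∈N , _) → n , x∈N)))
    (≐-trans (μ-additive fresh fresh-disjoint)
             (series-0∞ _ (λ n → null-⊆ proj₁ (N≈0 n))))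
    where
    before : ℕ → BSet
    before zero   = ∅ᴮ
    before (1+ n) = proj₁ (before n) ∪ proj₁ (N n) , ∪-borel (proj₂ (before n)) (proj₂ (N n))

    fresh : ℕ → BSet
    fresh n = proj₁ (N n) ∖ proj₁ (before n) , ∖-borel (proj₂ (N n)) (proj₂ (before n))

    N⊆before : ∀ {m n} → m ℕ.< n → proj₁ (N m) ⊆ proj₁ (before n)
    N⊆before {n = 1+ n} m<1+n x∈N with ℕ.m<1+n⇒m<n∨m≡n m<1+n
    ... | inj₁ m<n    = inj₁ (N⊆before m<n x∈N)
    ... | inj₂ ≡.refl = inj₂ x∈N

    fresh-disjoint : ∀ {m n} → m ≢ n → proj₁ (fresh m) ⊥ proj₁ (fresh n)
    fresh-disjoint {m} {n} m≢n ((x∈Nₘ , x∉m) , (x∈Nₙ , x∉n)) with ℕ.<-cmp m n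
    ... | tri< m<n _ _ = x∉n (N⊆before m<n x∈Nₘ)
    ... | tri≈ _ m≡n _ = m≢n m≡n
    ... | tri> _ _ n<m = x∉m (N⊆before n<m x∈Nₙ)

    mutual
      before⊆⋃fresh : ∀ n → proj₁ (before n) ⊆ ⋃ ℕ (proj₁ ∘ fresh)
      before⊆⋃fresh (1+ n) (inj₁ x∈before) = before⊆⋃fresh n x∈before
      before⊆⋃fresh (1+ n) (inj₂ x∈N)      = N⊆⋃fresh n x∈N

      -- The mutual recursion descends to the least index whose set contains the point; there the
      -- point is fresh.
      N⊆⋃fresh : ∀ n → proj₁ (N n) ⊆ ⋃ ℕ (proj₁ ∘ fresh)
      N⊆⋃fresh n {x} x∈N with dec {x ∈ proj₁ (before n)}
      ... | yes x∈before = before⊆⋃fresh n x∈before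
      ... | no  x∉before = n , x∈N , x∉before

  negl-⊆ : ∀ {A B} → A ⊆ B → Negl B → Negl A
  negl-⊆ A⊆B (N , B⊆N , N≈0) = N , B⊆N ∘ A⊆B , N≈0

  negl-∅ : ∀ {A} → (∀ {x} → x ∉ A) → Negl A
  negl-∅ A-empty = ∅ᴮ , (λ x∈A → ⊥-elim (A-empty x∈A)) , μ-∅

  negl-⋃ : {A : ℕ → Pred Point ℓ} → (∀ n → Negl (A n)) → Negl (⋃ ℕ A)
  negl-⋃ A-negl =
      (_ , union (λ n → proj₂ (proj₁ (A-negl n))))
    , (λ (n , x∈A) → n , proj₁ (proj₂ (A-negl n)) x∈A)
    , null-⋃ (λ n → proj₁ (A-negl n)) (λ n → proj₂ (proj₂ (A-negl n)))

  negl-∪ : ∀ {A B} → Negl A → Negl B → Negl (A ∪ B)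
  negl-∪ {A} {B} A-negl B-negl =
    negl-⊆ [ (0 ,_) , (1 ,_) ] (negl-⋃ family-negl)
    where
    family : ℕ → Pred Point ℓ
    family zero   = A
    family (1+ _) = B
    family-negl : ∀ n → Negl (family n)
    family-negl zero   = A-negl
    family-negl (1+ _) = B-negl

  positive⇒¬negl : (A : BSet) → Positive (measure A) → ¬ Negl (proj₁ A)
  positive⇒¬negl A A>0 (N , A⊆N , N≈0) = ≈0∞⇒¬Positive (measure A) (null-⊆ {A} {N} A⊆N N≈0) A>0

  -- A Borel set of measure zero is its own null cover.
  ¬negl⇒positive : (A : BSet) → ¬ Negl (proj₁ A) → Positive (measure A)
  ¬negl⇒positive A A-fat = decidable-stable (lower-em em)
    (λ A≯0 → A-fat (A , id , ¬Positive⇒≈0∞ (measure A) A≯0))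

  -- Inclusion and equality up to negligible sets.

  infix 4 _⊑_

  -- One half of `EqualUpToNegligible`. Working with the halves lets covering and disjointness be
  -- transported by monotonicity.
  _⊑_ : Pred Point ℓ → Pred Point ℓ → Set (suc ℓ)
  A ⊑ B = Negl (A ∖ B)

  ⊆⇒⊑ : ∀ {A B} → A ⊆ B → A ⊑ B
  ⊆⇒⊑ A⊆B = negl-∅ (λ (x∈A , x∉B) → x∉B (A⊆B x∈A))

  ⊑-trans : ∀ {A B C} → A ⊑ B → B ⊑ C → A ⊑ C
  ⊑-trans {A} {B} {C} A⊑B B⊑C = negl-⊆ split (negl-∪ A⊑B B⊑C)
    where
    split : A ∖ C ⊆ (A ∖ B) ∪ (B ∖ C)
    split {x} (x∈A , x∉C) with dec {x ∈ B}
    ... | yes x∈B = inj₂ (x∈B , x∉C)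
    ... | no  x∉B = inj₁ (x∈A , x∉B)

  negl-∩-⊑ : ∀ {A A′ B B′} → A ⊑ A′ → B ⊑ B′ → Negl (A′ ∩ B′) → Negl (A ∩ B)
  negl-∩-⊑ {A} {A′} {B} {B′} A⊑A′ B⊑B′ negl =
    negl-⊆ split (negl-∪ A⊑A′ (negl-∪ B⊑B′ negl))
    where
    split : A ∩ B ⊆ (A ∖ A′) ∪ ((B ∖ B′) ∪ (A′ ∩ B′))
    split {x} (x∈A , x∈B) with dec {x ∈ A′} | dec {x ∈ B′}
    ... | no  x∉A′ | _        = inj₁ (x∈A , x∉A′)
    ... | yes _    | no  x∉B′ = inj₂ (inj₁ (x∈B , x∉B′))
    ... | yes x∈A′ | yes x∈B′ = inj₂ (inj₂ (x∈A′ , x∈B′))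

  infix 4 _≡*_

  _≡*_ : Pred Point ℓ → Pred Point ℓ → Set (suc ℓ)
  _≡*_ = EqualUpToNegligible 𝒲

  ≡*⇒⊑ : ∀ {A B} → A ≡* B → A ⊑ B
  ≡*⇒⊑ = negl-⊆ inj₁

  ≡*⇒⊒ : ∀ {A B} → A ≡* B → B ⊑ A
  ≡*⇒⊒ = negl-⊆ inj₂

  ⊑-antisym : ∀ {A B} → A ⊑ B → B ⊑ A → A ≡* B
  ⊑-antisym = negl-∪

  ≡*-isEquivalence : IsEquivalence _≡*_
  ≡*-isEquivalence = record
    { refl  = ⊑-antisym (⊆⇒⊑ id) (⊆⇒⊑ id)
    ; sym   = λ A≡B → ⊑-antisym (≡*⇒⊒ A≡B) (≡*⇒⊑ A≡B)
    ; trans = λ A≡B B≡C → ⊑-antisym (⊑-trans (≡*⇒⊑ A≡B) (≡*⇒⊑ B≡C))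
                                    (⊑-trans (≡*⇒⊒ B≡C) (≡*⇒⊒ A≡B))
    }

-- Translates of sets in the space and in the group.

module Translation (em : ExcludedMiddle (suc ℓ))
  {𝒲 : BorelMeasureSpace ℓ} {G : Group ℓ ℓ} (G-countable : Countable (Group.setoid G))
  (α : Action G 𝒲) where
  open MeasureTheory em 𝒲
  open BorelMeasureSpace 𝒲
  open Action α
  private
    module G = Group G
    module W = TopologicalSpace space

  -- Countable unions are indexed by natural numbers, so families over `G` pass through this
  -- enumeration. It may repeat elements, and `index` picks a preimage up to equality in `G`.
  enum : ℕ → G.Carrier
  enum = Surjection.to G-countable

  index : G.Carrier → ℕ
  index = Surjection.to⁻ G-countable

  enum-index : ∀ g → enum (index g) G.≈ g
  enum-index = Surjection.to∘to⁻ G-countable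

  index-sym : ∀ g → g G.≈ enum (index g)
  index-sym g = G.sym (enum-index g)

  ·-congˡ : ∀ {g h} → g G.≈ h → ∀ x → g · x W.≈ h · x
  ·-congˡ g≈h x = ·-cong g≈h W.refl

  ·-congʳ : ∀ g {x y} → x W.≈ y → g · x W.≈ g · y
  ·-congʳ g = ·-cong G.refl

  translate-cong : ∀ {A g h} → g G.≈ h → g ·ˢ A ⊆ h ·ˢ A
  translate-cong g≈h (x , x∈A , gx≈y) = x , x∈A , W.trans (·-congˡ (G.sym g≈h) x) gx≈y

  translate-borel : G.Carrier → BSet → BSet
  translate-borel g = imageBorelSet space (homeomorphism g)

  g⁻¹g·x≈x : ∀ g x → g G.⁻¹ · g · x W.≈ x
  g⁻¹g·x≈x g x = W.trans (W.sym (·-compose (g G.⁻¹) g x))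
    (W.trans (·-congˡ (G.inverseˡ g) x) (·-identity x))

  translate-inverse : ∀ g (A : BSet) → g G.⁻¹ ·ˢ (g ·ˢ proj₁ A) ≐ proj₁ A
  translate-inverse g (A , bA) =
      -- The original point is recovered only up to equality of points, which Borel sets respect.
      (λ (y , (x , x∈A , gx≈y) , g⁻¹y≈z) → Borel-respects space bA
         (W.trans (W.sym (g⁻¹g·x≈x g x)) (W.trans (·-congʳ _ gx≈y) g⁻¹y≈z)) x∈A)
    , (λ {x} x∈A → g · x , (x , x∈A , W.refl) , g⁻¹g·x≈x g x)

  -- Preservation of positive measure, applied to the inverse of `g`: if the translate were
  -- positive, translating it back would make `A` positive.
  translate-null : ∀ g (A : BSet) → measure A ≈∞ 0∞ → measure (translate-borel g A) ≈∞ 0∞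
  translate-null g A A≈0 =
    ¬Positive⇒≈0∞ (measure (translate-borel g A)) λ gA>0 → ≈0∞⇒¬Positive (measure A) A≈0
    (proj₁ (μ-cong {translate-borel (g G.⁻¹) (translate-borel g A)} {A}
                   (translate-inverse g A))
      (negligibility-preserving (g G.⁻¹) (translate-borel g A) gA>0))

  translate-negl : ∀ g {A} → Negl A → Negl (g ·ˢ A)
  translate-negl g (N , A⊆N , N≈0) =
      translate-borel g N
    , (λ (x , x∈A , gx≈y) → x , A⊆N x∈A , gx≈y)
    , translate-null g N N≈0

  translate-⊑ : ∀ g {A B} → A ⊑ B → g ·ˢ A ⊑ g ·ˢ B
  translate-⊑ g A⊑B = negl-⊆
    (λ ((x , x∈A , gx≈y) , y∉gB) → x , (x∈A , λ x∈B → y∉gB (x , x∈B , gx≈y)) , gx≈y)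
    (translate-negl g A⊑B)

  leftTranslateˢ : G.Carrier → Subset G.setoid ℓ → Subset G.setoid ℓ
  leftTranslateˢ g S = record
    { elements = leftTranslate G g (elements S)
    ; respects = λ x≈y (s , s∈S , gs≈x) → s , s∈S , G.trans gs≈x x≈y
    }

  -- The product set CS. The covering condition for a group cotiler says that it is all of `G`.
  productˢ : Subset G.setoid ℓ → Subset G.setoid ℓ → Subset G.setoid ℓ
  productˢ C S = record
    { elements = λ x → Σ[ g ∈ G.Carrier ] g ∈ elements C × x ∈ leftTranslate G g (elements S)
    ; respects = λ x≈y (g , g∈C , x∈gS) →
        g , g∈C , Subset.respects (leftTranslateˢ g S) x≈y x∈gS
    }

  leftTranslate-cong : ∀ {S : Pred G.Carrier ℓ} {g h} →
                       g G.≈ h → leftTranslate G g S ⊆ leftTranslate G h S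
  leftTranslate-cong g≈h (s , s∈S , gs≈x) =
    s , s∈S , G.trans (G.∙-congʳ (G.sym g≈h)) gs≈x

  -- Unions of grid cells.

  module Grid (K : Tile 𝒲) (grid : YieldsGrid α K) where
    private module Grid = IsTiling (proj₂ grid)

    cell : G.Carrier → Pred Point ℓ
    cell g = g ·ˢ Tile.set K

    ⟨_⟩ : Subset G.setoid ℓ → Pred Point ℓ
    ⟨ S ⟩ = translates α (Tile.set K) S

    cell-⊆ : ∀ S {g} → g ∈ elements S → cell g ⊆ ⟨ S ⟩
    cell-⊆ S {g} g∈S y∈gK = g , g∈S , y∈gK

    ¬negl-cell : ∀ g → ¬ Negl (cell g)
    ¬negl-cell g = positive⇒¬negl (translate-borel g (Tile.borelSet K))
      (negligibility-preserving g (Tile.borelSet K) (Tile.positive K))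

    Overlap : Pred Point ℓ
    Overlap y = ∃₂ λ g h → ¬ g G.≈ h × y ∈ cell g × y ∈ cell h

    -- The grid makes each pair of distinct cells almost disjoint, and countability of `G` leaves
    -- countably many pairs.
    negl-overlap : Negl Overlap
    negl-overlap = negl-⊆
      (λ (g , h , g≉h , y∈gK , y∈hK) →
          index g , index h
        , (λ e → g≉h (G.trans (index-sym g) (G.trans e (enum-index h))))
        , translate-cong (index-sym g) y∈gK , translate-cong (index-sym h) y∈hK)
      (negl-⋃ λ m → negl-⋃ λ n → negl-pair m n)
      where
      negl-pair : ∀ m n → Negl (λ y → ¬ enum m G.≈ enum n × y ∈ cell (enum m) × y ∈ cell (enum n))
      negl-pair m n with dec {enum m G.≈ enum n}
      -- Two indices may enumerate the same group element; such a pair contributes no overlap.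
      ... | yes e = negl-∅ (λ (m≉n , _) → m≉n e)
      ... | no ¬e = negl-⊆ proj₂ (Grid.disjoint tt tt ¬e)

    ⟨⟩-mono : ∀ S S′ → elements S ⊆ elements S′ → ⟨ S ⟩ ⊆ ⟨ S′ ⟩
    ⟨⟩-mono _ _ S⊆S′ (g , g∈S , y∈gK) = g , S⊆S′ g∈S , y∈gK

    -- If `g` were missing from `S′`, each point of its cell would lie outside `⟨ S′ ⟩` or in a
    -- second, different cell. Both cases are negligible, but the cell is not.
    ⟨⟩-cancel-⊑ : ∀ S S′ → ⟨ S ⟩ ⊑ ⟨ S′ ⟩ → elements S ⊆ elements S′
    ⟨⟩-cancel-⊑ S S′ S⊑S′ {g} g∈S = decidable-stable dec λ g∉S′ →
      ¬negl-cell g (negl-⊆ (split g∉S′) (negl-∪ S⊑S′ negl-overlap))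
      where
      split : g ∉ elements S′ → cell g ⊆ (⟨ S ⟩ ∖ ⟨ S′ ⟩) ∪ Overlap
      split g∉S′ {y} y∈gK with dec {y ∈ ⟨ S′ ⟩}
      ... | no  y∉ = inj₁ (cell-⊆ S g∈S y∈gK , y∉)
      ... | yes (h , h∈S′ , y∈hK) =
        inj₂ (g , h , (λ g≈h → g∉S′ (Subset.respects S′ (G.sym g≈h) h∈S′)) , y∈gK , y∈hK)

    ⊥⇒negl-∩ : ∀ S S′ → elements S ⊥ elements S′ → Negl (⟨ S ⟩ ∩ ⟨ S′ ⟩)
    ⊥⇒negl-∩ S S′ S⊥S′ = negl-⊆
      (λ ((g , g∈S , y∈gK) , (h , h∈S′ , y∈hK)) →
        g , h , (λ g≈h → S⊥S′ (Subset.respects S g≈h g∈S , h∈S′)) , y∈gK , y∈hK)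
      negl-overlap

    -- A common element would put a whole cell into the intersection.
    negl-∩⇒⊥ : ∀ S S′ → Negl (⟨ S ⟩ ∩ ⟨ S′ ⟩) → elements S ⊥ elements S′
    negl-∩⇒⊥ S S′ negl {g} (g∈S , g∈S′) =
      ¬negl-cell g (negl-⊆ (λ y∈gK → cell-⊆ S g∈S y∈gK , cell-⊆ S′ g∈S′ y∈gK) negl)

    translate-⟨⟩ : ∀ g S → g ·ˢ ⟨ S ⟩ ≐ ⟨ leftTranslateˢ g S ⟩
    translate-⟨⟩ g S =
        (λ (x , (s , s∈S , k , k∈K , sk≈x) , gx≈y) →
            g G.∙ s , (s , s∈S , G.refl) , k , k∈K
          , W.trans (·-compose g s k) (W.trans (·-congʳ g sk≈x) gx≈y))
      , (λ (h , (s , s∈S , gs≈h) , k , k∈K , hk≈y) →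
            s · k , (s , s∈S , k , k∈K , W.refl)
          , W.trans (W.sym (·-compose g s k)) (W.trans (·-congˡ gs≈h k) hk≈y))

    -- `S` comes without an enumeration of its own, so the union runs over all of `G` and membership
    -- in `S` acts as a guard on each cell.
    ⟨⟩-borel : (S : Subset G.setoid ℓ) → BSet
    ⟨⟩-borel S = ⟨ S ⟩ , ≐-borel
      ( (λ (n , n∈S , y∈nK) → enum n , n∈S , y∈nK)
      , (λ (g , g∈S , y∈gK) →
            index g , Subset.respects S (index-sym g) g∈S , translate-cong (index-sym g) y∈gK))
      (union λ n → guard-borel (proj₂ (translate-borel (enum n) (Tile.borelSet K))))

    -- The inverse of Ψ on finite tiles. The tile is `⟨ S ⟩` itself, which has positive measure
    -- because it contains the cell of the given element.
    polyTile : FiniteTile G → PolyTile α K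
    polyTile (F , g , g∈S) = record
      { tile  = record
        { borelSet = ⟨⟩-borel S
        ; positive = ¬negl⇒positive (⟨⟩-borel S)
            (λ negl → ¬negl-cell g (negl-⊆ (cell-⊆ S g∈S) negl))
        }
      ; parts = F
      ; tiles = record
        { disjoint = λ _ _ → Grid.disjoint tt tt
        ; covers   = IsEquivalence.refl ≡*-isEquivalence
        }
      }
      where
      S : Subset G.setoid ℓ
      S = FiniteSubset.subset F

    -- The bijection between poly-tiles and finite tiles.

    module _ (T : PolyTile α K) where
      open PolyTile T using (tile; tiles)

      T≡⟨ΨT⟩ : Tile.set tile ≡* ⟨ Ψˢ α T ⟩
      T≡⟨ΨT⟩ = IsTiling.covers tiles

      -- With no parts, the tile would equal the empty set up to a negligible set, against its
      -- positive measure.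
      Ψ-nonempty : Satisfiable (elements (Ψˢ α T))
      Ψ-nonempty = decidable-stable dec λ empty →
        positive⇒¬negl (Tile.borelSet tile) (Tile.positive tile)
          (negl-⊆ (λ y∈T → y∈T , λ (g , g∈S , _) → empty (g , g∈S)) (≡*⇒⊑ T≡⟨ΨT⟩))

    Ψ-mono : ∀ T T′ → Tile.set (PolyTile.tile T) ⊑ Tile.set (PolyTile.tile T′) →
             elements (Ψˢ α T) ⊆ elements (Ψˢ α T′)
    Ψ-mono T T′ T⊑T′ = ⟨⟩-cancel-⊑ (Ψˢ α T) (Ψˢ α T′)
      (⊑-trans (≡*⇒⊒ (T≡⟨ΨT⟩ T)) (⊑-trans T⊑T′ (≡*⇒⊑ (T≡⟨ΨT⟩ T′))))

    Ψ-cancel-⊆ : ∀ T T′ → elements (Ψˢ α T) ⊆ elements (Ψˢ α T′) →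
                 Tile.set (PolyTile.tile T) ⊑ Tile.set (PolyTile.tile T′)
    Ψ-cancel-⊆ T T′ S⊆S′ = ⊑-trans (≡*⇒⊑ (T≡⟨ΨT⟩ T))
      (⊑-trans (⊆⇒⊑ (⟨⟩-mono (Ψˢ α T) (Ψˢ α T′) S⊆S′)) (≡*⇒⊒ (T≡⟨ΨT⟩ T′)))

    -- Includes the uniqueness of the finite set of parts: `T` and `T′` may be the same tile with
    -- two decompositions.
    Ψ-cong : ∀ T T′ → _≡ᵖ_ α {K} T T′ → elements (Ψˢ α T) ≐ elements (Ψˢ α T′)
    Ψ-cong T T′ T≡T′ = Ψ-mono T T′ (≡*⇒⊑ T≡T′) , Ψ-mono T′ T (≡*⇒⊒ T≡T′)

    Ψ-isBijection : IsBijection (_≡ᵖ_ α {K}) (_≐ᵗ_ G) (λ T → Ψ α T , Ψ-nonempty T)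
    Ψ-isBijection = record
      { isInjection = record
        { isCongruent = record
          { cong           = λ {T} {T′} → Ψ-cong T T′
          ; isEquivalence₁ = record
            { refl  = ≡*.refl
            ; sym   = ≡*.sym
            ; trans = ≡*.trans
            }
          ; isEquivalence₂ = record
            { refl  = ≐-refl
            ; sym   = ≐-sym
            ; trans = ≐-trans
            }
          }
        ; injective = λ {T} {T′} (S⊆S′ , S′⊆S) →
            ⊑-antisym (Ψ-cancel-⊆ T T′ S⊆S′) (Ψ-cancel-⊆ T′ T S′⊆S)
        }
      -- The parts of `polyTile F` are `F` by definition, so only congruence remains to be shown.
      ; surjective = λ F → polyTile F , λ {T} → Ψ-cong T (polyTile F)
      }
      where module ≡* = IsEquivalence ≡*-isEquivalence

    -- Transfer of cotilers.

    module _ (T : PolyTile α K) (C : Subset G.setoid ℓ) where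
      private
        A : Pred Point ℓ
        A = Tile.set (PolyTile.tile T)

        S : Subset G.setoid ℓ
        S = Ψˢ α T

      translate⊑ : ∀ g → g ·ˢ A ⊑ ⟨ leftTranslateˢ g S ⟩
      translate⊑ g = ⊑-trans (translate-⊑ g (≡*⇒⊑ (T≡⟨ΨT⟩ T)))
                             (⊆⇒⊑ (proj₁ (translate-⟨⟩ g S)))

      translate⊒ : ∀ g → ⟨ leftTranslateˢ g S ⟩ ⊑ g ·ˢ A
      translate⊒ g = ⊑-trans (⊆⇒⊑ (proj₂ (translate-⟨⟩ g S)))
                             (translate-⊑ g (≡*⇒⊒ (T≡⟨ΨT⟩ T)))

      -- Each translate has its own negligible exceptional set. `C` need not be enumerated: the
      -- exceptional sets of all group elements together still form a countable union.
      translates⊑ : translates α A C ⊑ ⟨ productˢ C S ⟩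
      translates⊑ = negl-⊆
        (λ ((g , g∈C , y∈gA) , y∉CS) →
            index g , translate-cong (index-sym g) y∈gA
          , λ (x , x∈gS , y∈xK) →
              y∉CS (x , (g , g∈C , leftTranslate-cong (enum-index g) x∈gS) , y∈xK))
        (negl-⋃ (translate⊑ ∘ enum))

      translates⊒ : ⟨ productˢ C S ⟩ ⊑ translates α A C
      translates⊒ = negl-⊆
        (λ ((x , (g , g∈C , x∈gS) , y∈xK) , y∉CA) →
            index g , (x , leftTranslate-cong (index-sym g) x∈gS , y∈xK)
          , λ y∈gA → y∉CA (g , g∈C , translate-cong (enum-index g) y∈gA))
        (negl-⋃ (translate⊒ ∘ enum))

      cotiler⇒groupCotiler : IsCotiler α (PolyTile.tile T) C → IsGroupCotiler G S C
      cotiler⇒groupCotiler cotiler = record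
        { disjoint = λ {g} {h} g∈C h∈C g≉h →
            negl-∩⇒⊥ (leftTranslateˢ g S) (leftTranslateˢ h S)
              (negl-∩-⊑ (translate⊒ g) (translate⊒ h) (disjoint g∈C h∈C g≉h))
        ; covers = λ x → ⟨⟩-cancel-⊑ (whole α) (productˢ C S)
            -- The union of all cells lies in the space, which is almost covered by the translates
            -- of `T` and so by the cells of CS. Cancelling cells puts all of `G` into CS.
            (⊑-trans (⊆⇒⊑ (λ _ → tt)) (⊑-trans (≡*⇒⊑ covers) translates⊑)) tt
        }
        where open IsTiling cotiler

      groupCotiler⇒cotiler : IsGroupCotiler G S C → IsCotiler α (PolyTile.tile T) C
      groupCotiler⇒cotiler cotiler = record
        { disjoint = λ {g} {h} g∈C h∈C g≉h →
            negl-∩-⊑ (translate⊑ g) (translate⊑ h)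
              (⊥⇒negl-∩ (leftTranslateˢ g S) (leftTranslateˢ h S) (disjoint g∈C h∈C g≉h))
        ; covers = ⊑-antisym
            -- The grid almost covers the space, and since CS is all of `G`, its cells are those of
            -- the grid.
            (⊑-trans (≡*⇒⊑ Grid.covers)
              (⊑-trans (⊆⇒⊑ (⟨⟩-mono (whole α) (productˢ C S) (λ {x} _ → covers x))) translates⊒))
            (⊆⇒⊑ (λ _ → tt))
        }
        where open IsGroupCotiler cotiler

corollary8 : ∀ {ℓ} → ExcludedMiddle (suc ℓ) →
    (𝒲 : BorelMeasureSpace ℓ) (G : Group ℓ ℓ) → Countable (Group.setoid G) →
    (α : Action G 𝒲) (K : Tile 𝒲) → YieldsGrid α K →
    (Σ[ nonempty ∈ (∀ (T : PolyTile α K) → Satisfiable (elements (Ψˢ α T))) ]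
    IsBijection (_≡ᵖ_ α {K}) (_≐ᵗ_ G) (λ T → Ψ α T , nonempty T))
    × (∀ (T : PolyTile α K) (C : Subset (Group.setoid G) ℓ) →
    IsCotiler α (PolyTile.tile T) C ⇔ IsGroupCotiler G (Ψˢ α T) C)
corollary8 em 𝒲 G G-countable α K grid =
    (Ψ-nonempty , Ψ-isBijection)
  , λ T C → mk⇔ (cotiler⇒groupCotiler T C) (groupCotiler⇒cotiler T C)
  where
  open Translation em G-countable α
  open Grid K grid
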